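{- For every integer $r \geq 2$, \[n(r,3,3) = \begin{cases} r + r/2 & \text{if } r \text{ is even;}\\ r + \lceil r/2\rceil + 1 & \text{if } r \text{ is odd and } \lceil r/2\rceil \text{ is even;}\\ r + \lceil r/2\rceil + 2 & \text{if } r \text{ is odd and } \lceil r/2\rceil \text{ is odd.}\end{cases}\]
   Context: All graphs are finite and simple. For integers $r\geq 2$, $g\geq 3$, $\chi\geq 2$, an $(r,g,\chi)$-graph is an $r$-regular graph with girth (length of a shortest cycle) exactly $g$ and chromatic number exactly $\chi$. An $(r,g,\chi)$-cage is an $(r,g,\chi)$-graph of minimum order, and $n(r,g,\chi)$ denotes the order of an $(r,g,\chi)$-cage, i.e. the minimum number of vertices of an $(r,g,\chi)$-graph. -}

module Defs where

open import Data.Bool.Base using (Bool; true; false)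
open import Data.Fin.Base using (Fin; zero; suc; inject₁; fromℕ)
open import Data.Fin.Subset using (Subset; ∣_∣)
open import Data.Nat.Base using (ℕ; suc; _≤_)
open import Data.Product.Base using (Σ-syntax; _×_)
open import Data.Vec.Base using (tabulate)
open import Function.Definitions using (Injective)
open import Relation.Binary.PropositionalEquality using (_≡_; _≢_)

-- Up to isomorphism, a finite simple graph of order n has vertex set Fin n.
record Graph (n : ℕ) : Set where
  field
    adj     : Fin n → Fin n → Bool
    adj-sym : ∀ u v → adj u v ≡ adj v u
    no-loop : ∀ v → adj v v ≡ false

  _~_ : Fin n → Fin n → Set
  u ~ v = adj u v ≡ true

  neighbours : Fin n → Subset n
  neighbours v = tabulate (adj v)

  degree : Fin n → ℕ
  degree v = ∣ neighbours v ∣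

module _ {n : ℕ} (G : Graph n) where
  open Graph G

  IsRegular : ℕ → Set
  IsRegular r = ∀ v → degree v ≡ r

  -- The index is the length: a cycle c₀ ~ c₁ ~ ⋯ ~ c_l ~ c₀ through l + 1
  -- distinct vertices has length l + 1.
  data Cycle : ℕ → Set where
    cycle : ∀ {l} → 2 ≤ l →
            (c : Fin (suc l) → Fin n) →
            Injective _≡_ _≡_ c →
            (∀ (i : Fin l) → c (inject₁ i) ~ c (suc i)) →
            c (fromℕ l) ~ c zero →
            Cycle (suc l)

  HasGirth : ℕ → Set
  HasGirth g = Cycle g × (∀ k → Cycle k → g ≤ k)

  Colourable : ℕ → Set
  Colourable k = Σ[ f ∈ (Fin n → Fin k) ] (∀ u v → u ~ v → f u ≢ f v)

  HasChromaticNumber : ℕ → Set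
  HasChromaticNumber χ = Colourable χ × (∀ k → Colourable k → χ ≤ k)

record IsRGχGraph (r g χ : ℕ) {n : ℕ} (G : Graph n) : Set where
  field
    regular   : IsRegular G r
    girth     : HasGirth G g
    chromatic : HasChromaticNumber G χ

record IsCage (r g χ : ℕ) {n : ℕ} (G : Graph n) : Set where
  field
    isRGχGraph : IsRGχGraph r g χ G
    minimum    : ∀ {m} (H : Graph m) → IsRGχGraph r g χ H → n ≤ m

-- n(r,g,χ) = m, as a relation because n(r,g,χ) is undefined when no
-- (r,g,χ)-graph exists; by minimality at most one m is related to (r,g,χ).
n⟨_,_,_⟩≡_ : (r g χ m : ℕ) → Set
n⟨ r , g , χ ⟩≡ m = Σ[ G ∈ Graph m ] IsCage r g χ G

infix 4 n⟨_,_,_⟩≡_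

{-# OPTIONS --safe #-}

-- In an r-regular graph on n vertices every colour class has at most n − r
-- vertices, so three classes give 3r ≤ 2n, and if this is not an equality then
-- two classes are deficient, so 3r + 2 ≤ 2n; when r is odd n is even by the
-- handshake lemma.  The bounds are attained by K_{k,k,k} for r even, by
-- K_{k,k,k} minus a perfect matching for r = 2k − 1 with k even, and for
-- r = 2k + 1 with k even by K_{k+2,k+1,k+1} minus k/2 paths P₆ and one path P₄.

module Submission where

open import Defs
import Algebra.Properties.CommutativeMonoid.Sum as Sum
open import Data.Bool.Base using (Bool; true; false; if_then_else_; not; _∧_)
import Data.Bool.Properties as Bool
open import Data.Fin.Base using (Fin; zero; suc; toℕ; splitAt; remQuot; combine; punchOut; _↑ˡ_; _↑ʳ_)
open import Data.Fin.Properties using (_≟_; all?; any?; ¬∀⟶∃¬; splitAt-↑ˡ; splitAt-↑ʳ;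
  remQuot-combine; punchOut-injective; injective⇒≤)
open import Data.Fin.Patterns using (0F; 1F; 2F; 3F; 4F; 8F)
open import Data.Fin.Subset using (∣_∣)
open import Data.Nat.Base using (ℕ; zero; suc; _+_; _*_; _≤_; _<_; _/_; ⌈_/2⌉; z≤n; s≤s; ∣_-_∣)
open import Data.Nat.Divisibility using (_∣_; _∤_; divides; divides-refl; ∣-refl; ∣m∣n⇒∣m+n; _∣0)
open import Data.Nat.DivMod using (m*n/n≡m)
import Data.Nat.Properties as ℕ
open import Data.Nat.Tactic.RingSolver using (solve-∀)
open import Data.Product.Base using (∃; _×_; _,_; proj₁; proj₂; map)
open import Data.Sum.Base using (inj₁; inj₂; [_,_]′)
open import Data.Vec.Base using (Vec; []; _∷_; lookup; tabulate)
open import Function.Bundles using (mk⇔)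
open import Function.Base using (_∘_; case_of_)
open import Function.Definitions using (Injective)
open import Relation.Binary.PropositionalEquality
open import Relation.Nullary using (Dec; yes; no; does; contradiction)
open import Relation.Nullary.Decidable using (decidable-stable; dec-true; does-⇔; from-yes; ¬?; _→-dec_; _×-dec_)
open Sum ℕ.+-0-commutativeMonoid
  using (sum; sum-syntax; sum-cong-≗; ∑-distrib-+; ∑-comm)

-- Finite sums and counting.

⟦_⟧ : Bool → ℕ
⟦ b ⟧ = if b then 1 else 0

#_ : ∀ {n} → (Fin n → Bool) → ℕ
# f = sum (⟦_⟧ ∘ f)

∣tabulate∣≡# : ∀ {n} (f : Fin n → Bool) → ∣ tabulate f ∣ ≡ # f
∣tabulate∣≡# {zero}  f = refl
∣tabulate∣≡# {suc n} f with f zero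
... | true  = cong suc (∣tabulate∣≡# (f ∘ suc))
... | false = ∣tabulate∣≡# (f ∘ suc)

∑-const : ∀ n a → ∑[ i < n ] a ≡ n * a
∑-const zero    a = refl
∑-const (suc n) a = cong (a +_) (∑-const n a)

∑-mono-≤ : ∀ {n} {f g : Fin n → ℕ} → (∀ i → f i ≤ g i) → sum f ≤ sum g
∑-mono-≤ {zero}  f≤g = z≤n
∑-mono-≤ {suc n} f≤g = ℕ.+-mono-≤ (f≤g zero) (∑-mono-≤ (f≤g ∘ suc))

∑-mono-< : ∀ {n} {f g : Fin n → ℕ} → (∀ i → f i ≤ g i) → ∀ i → f i < g i → sum f < sum g
∑-mono-< f≤g zero    fi<gi = ℕ.+-mono-<-≤ fi<gi (∑-mono-≤ (f≤g ∘ suc))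
∑-mono-< f≤g (suc i) fi<gi = ℕ.+-mono-≤-< (f≤g zero) (∑-mono-< (f≤g ∘ suc) i fi<gi)

∑-+ : ∀ m {n} (f : Fin (m + n) → ℕ) → sum f ≡ ∑[ i < m ] f (i ↑ˡ n) + ∑[ j < n ] f (m ↑ʳ j)
∑-+ zero    f = refl
∑-+ (suc m) f = trans (cong (f zero +_) (∑-+ m (f ∘ suc))) (sym (ℕ.+-assoc (f zero) _ _))

∑-* : ∀ m {n} (f : Fin (m * n) → ℕ) → sum f ≡ ∑[ i < m ] ∑[ j < n ] f (combine i j)
∑-* zero        f = refl
∑-* (suc m) {n} f = trans (∑-+ n f) (cong (∑[ j < n ] f (j ↑ˡ (m * n)) +_) (∑-* m (f ∘ (n ↑ʳ_))))

-- One b is added on the left so that no subtraction occurs on the right.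
∑-if : ∀ {n} (i : Fin n) a b → ∑[ j < n ] (if does (i ≟ j) then a else b) + b ≡ a + n * b
∑-if {suc n} zero    a b = trans (cong (λ x → a + x + b) (∑-const n b)) (identity a b (n * b))
  where
  identity : ∀ a b c → a + c + b ≡ a + (b + c)
  identity = solve-∀
∑-if {suc n} (suc i) a b = trans (ℕ.+-assoc b _ b) (trans (cong (b +_) (∑-if i a b)) (identity a b (n * b)))
  where
  identity : ∀ a b c → b + (a + c) ≡ a + (b + c)
  identity = solve-∀

#-singleton : ∀ {n} (i : Fin n) → # (λ j → does (i ≟ j)) ≡ 1
#-singleton {n} i = trans (sym (ℕ.+-identityʳ _)) (trans (∑-if i 1 0) (cong suc (ℕ.*-zeroʳ n)))

-- Cliques, chromatic number and girth.

module _ {n} (G : Graph n) where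
  open Graph G

  degree≡# : ∀ v → degree v ≡ # (adj v)
  degree≡# v = ∣tabulate∣≡# (adj v)

  ~⇒≢ : ∀ {u v} → u ~ v → u ≢ v
  ~⇒≢ {u} u~v refl = case trans (sym u~v) (no-loop u) of λ ()

  Clique : ∀ {k} → (Fin k → Fin n) → Set
  Clique c = ∀ i j → i ≢ j → c i ~ c j

≢⇒injective : ∀ {k} {A : Set} {f : Fin k → A} → (∀ i j → i ≢ j → f i ≢ f j) → Injective _≡_ _≡_ f
≢⇒injective f≢ {i} {j} fi≡fj = decidable-stable (i ≟ j) λ i≢j → f≢ i j i≢j fi≡fj

-- A proper colouring is injective on a clique. For a triangle this gives the lower bound 3 on the
-- chromatic number.
clique-order : ∀ {n k χ} (G : Graph n) {c : Fin k → Fin n} → Clique G c → Colourable G χ → k ≤ χ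
clique-order G c-clique (f , proper) =
  injective⇒≤ (≢⇒injective λ i j i≢j → proper _ _ (c-clique i j i≢j))

-- `Cycle` admits only lengths of at least 3, so a triangle is a shortest cycle.
triangle⇒girth3 : ∀ {n} (G : Graph n) {c : Fin 3 → Fin n} → Clique G c → HasGirth G 3
triangle⇒girth3 G {c} c-clique =
  cycle ℕ.≤-refl c (≢⇒injective λ i j i≢j → ~⇒≢ G (c-clique i j i≢j))
    (λ { zero → c-clique _ _ λ () ; (suc zero) → c-clique _ _ λ () })
    (c-clique _ _ λ ())
  , λ { _ (cycle 2≤l _ _ _ _) → s≤s 2≤l }

-- The handshake lemma.

2∣∑∑ : ∀ {n} (a : Fin n → Fin n → ℕ) → (∀ i j → a i j ≡ a j i) → (∀ i → a i i ≡ 0) →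
       2 ∣ ∑[ i < n ] ∑[ j < n ] a i j
2∣∑∑ {zero}  a a-sym a-diag = 2 ∣0
2∣∑∑ {suc n} a a-sym a-diag = subst (2 ∣_) (sym split)
  (∣m∣n⇒∣m+n (divides row refl) (2∣∑∑ (λ i j → a (suc i) (suc j)) (λ i j → a-sym _ _) (a-diag ∘ suc)))
  where
  row  = ∑[ j < n ] a zero (suc j)
  rest = ∑[ i < n ] ∑[ j < n ] a (suc i) (suc j)

  identity : ∀ x y → x + (x + y) ≡ x * 2 + y
  identity = solve-∀

  open ≡-Reasoning
  -- By symmetry the first column repeats the first row, and the corner is 0, so twice `row` is
  -- peeled off.
  split : ∑[ i < suc n ] ∑[ j < suc n ] a i j ≡ row * 2 + rest
  split = begin
    (a zero zero + row) + ∑[ i < n ] (a (suc i) zero + ∑[ j < n ] a (suc i) (suc j))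
      ≡⟨ cong₂ _+_ (cong (_+ row) (a-diag zero)) (∑-distrib-+ (λ i → a (suc i) zero) _) ⟩
    row + (∑[ i < n ] a (suc i) zero + rest)
      ≡⟨ cong (λ x → row + (x + rest)) (sum-cong-≗ λ i → a-sym (suc i) zero) ⟩
    row + (row + rest)
      ≡⟨ identity row rest ⟩
    row * 2 + rest ∎

-- The degree sum n * r is the entry sum of the adjacency matrix, which is symmetric with zero
-- diagonal.
handshake : ∀ {n r} (G : Graph n) → IsRegular G r → 2 ∣ n * r
handshake {n} {r} G regular = subst (2 ∣_)
  (trans (sum-cong-≗ λ v → trans (sym (degree≡# G v)) (regular v)) (∑-const n r))
  (2∣∑∑ (λ u v → ⟦ adj u v ⟧) (λ u v → cong ⟦_⟧ (adj-sym u v)) (cong ⟦_⟧ ∘ no-loop))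
  where open Graph G

-- Lower bounds on the order.

-- A vertex v of a class that is not of maximal size n − r has a non-neighbour u
-- of another colour, and then the class of u is not of maximal size either.
module ColourClasses {n r k} (G : Graph n) (regular : IsRegular G r)
                     (chromatic : HasChromaticNumber G (suc k)) where
  open Graph G

  colour : Fin n → Fin (suc k)
  colour = proj₁ (proj₁ chromatic)

  proper : ∀ u v → u ~ v → colour u ≢ colour v
  proper = proj₂ (proj₁ chromatic)

  size : Fin (suc k) → ℕ
  size c = # (λ u → does (colour u ≟ c))

  Strict : Fin (suc k) → Set
  Strict c = r + size c < n

  colour-surjective : ∀ c → ∃ λ v → colour v ≡ c
  colour-surjective c = decidable-stable (any? λ v → colour v ≟ c) λ unused →
    ℕ.1+n≰n (proj₂ chromatic k
      ( (λ v → punchOut (λ c≡ → unused (v , sym c≡)))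
      , λ u v u~v eq → proper u v u~v (punchOut-injective {i = c} _ _ eq)))

  ∑1≡n : ∑[ u < n ] 1 ≡ n
  ∑1≡n = trans (∑-const n 1) (ℕ.*-identityʳ n)

  ∑-size : sum size ≡ n
  ∑-size = begin
    ∑[ c < suc k ] ∑[ u < n ] ⟦ does (colour u ≟ c) ⟧ ≡⟨ ∑-comm (λ c u → ⟦ does (colour u ≟ c) ⟧) ⟩
    ∑[ u < n ] # (λ c → does (colour u ≟ c))          ≡⟨ sum-cong-≗ (λ u → #-singleton (colour u)) ⟩
    ∑[ u < n ] 1                                      ≡⟨ ∑1≡n ⟩
    n                                                 ∎
    where open ≡-Reasoning

  ∑-class : ∑[ c < suc k ] (r + size c) ≡ suc k * r + n
  ∑-class = trans (∑-distrib-+ (λ _ → r) size) (cong₂ _+_ (∑-const (suc k) r) ∑-size)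

  -- The adjacency matrix plus the matrix of the relation "same colour". Properness keeps the
  -- entries at most 1, and an entry 0 marks a non-neighbour of another colour.
  term : Fin n → Fin n → ℕ
  term v u = ⟦ adj v u ⟧ + ⟦ does (colour u ≟ colour v) ⟧

  ∑-term : ∀ v → sum (term v) ≡ r + size (colour v)
  ∑-term v = trans (∑-distrib-+ (⟦_⟧ ∘ adj v) _)
    (cong (_+ size (colour v)) (trans (sym (degree≡# G v)) (regular v)))

  term≤1 : ∀ v u → term v u ≤ 1
  term≤1 v u with adj v u in v~u | colour u ≟ colour v
  ... | true  | yes same = contradiction (sym same) (proper v u v~u)
  ... | true  | no _     = ℕ.≤-refl
  ... | false | yes _    = ℕ.≤-refl
  ... | false | no _     = z≤n

  term-sym : ∀ u v → term u v ≡ term v u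
  term-sym u v = cong₂ (λ a b → ⟦ a ⟧ + ⟦ b ⟧) (adj-sym u v)
    (does-⇔ (mk⇔ sym sym) (colour v ≟ colour u) (colour u ≟ colour v))

  term-same : ∀ v u → colour u ≡ colour v → 1 ≤ term v u
  term-same v u same rewrite dec-true (colour u ≟ colour v) same = ℕ.m≤n+m 1 _

  class≤ : ∀ c → r + size c ≤ n
  class≤ c with v , refl ← colour-surjective c =
    subst₂ _≤_ (∑-term v) ∑1≡n (∑-mono-≤ (term≤1 v))

  another-strict : ∀ c → Strict c → ∃ λ d → c ≢ d × Strict d
  another-strict c c-strict with v , refl ← colour-surjective c
    with u , missed ← ¬∀⟶∃¬ n (λ u → term v u ≡ 1) (λ u → term v u ℕ.≟ 1)
           (λ all → ℕ.<⇒≢ c-strict (trans (sym (∑-term v)) (trans (sum-cong-≗ all) ∑1≡n)))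
    = colour u
    , (λ same → missed (ℕ.≤-antisym (term≤1 v u) (term-same v u (sym same))))
    -- By symmetry row `u` has an entry below 1 at `v`, so its sum is below n.
    , subst₂ _<_ (∑-term u) ∑1≡n
        (∑-mono-< (term≤1 u) v (ℕ.≤∧≢⇒< (term≤1 u v) (missed ∘ trans (term-sym v u))))

  -- Here `w c` is a guaranteed shortfall of class c. On summing over the classes, the sizes total
  -- n, which cancels one of the k + 1 terms n on the right.
  weighted-bound : (w : Fin (suc k) → ℕ) → (∀ c → r + size c + w c ≤ n) →
                   suc k * r + sum w ≤ k * n
  weighted-bound w bound = ℕ.+-cancelˡ-≤ n _ _ (begin
    n + (suc k * r + sum w)             ≡⟨ identity n (suc k * r) (sum w) ⟩
    suc k * r + n + sum w               ≡⟨ cong (_+ sum w) ∑-class ⟨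
    ∑[ c < suc k ] (r + size c) + sum w ≡⟨ ∑-distrib-+ (λ c → r + size c) w ⟨
    ∑[ c < suc k ] (r + size c + w c)   ≤⟨ ∑-mono-≤ bound ⟩
    ∑[ c < suc k ] n                    ≡⟨ ∑-const (suc k) n ⟩
    n + k * n                           ∎)
    where
    open ℕ.≤-Reasoning
    identity : ∀ a b c → a + (b + c) ≡ b + a + c
    identity = solve-∀

  order-bound : suc k * r ≤ k * n
  order-bound = ℕ.m+n≤o⇒m≤o (suc k * r)
    (weighted-bound (λ _ → 0) λ c → subst (_≤ n) (sym (ℕ.+-identityʳ _)) (class≤ c))

  -- If every class were of size n - r, summing would give equality.
  some-strict : suc k * r ≢ k * n → ∃ Strict
  some-strict not-tight
    with c , loose ← ¬∀⟶∃¬ (suc k) (λ c → r + size c ≡ n) (λ c → r + size c ℕ.≟ n)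
           (λ tight → not-tight (ℕ.+-cancelʳ-≡ n _ _ (trans (sym ∑-class)
             (trans (sum-cong-≗ tight) (trans (∑-const (suc k) n) (ℕ.+-comm n (k * n)))))))
    = c , ℕ.≤∧≢⇒< (class≤ c) loose

  order-gap : suc k * r ≢ k * n → suc k * r + 2 ≤ k * n
  order-gap not-tight
    with c , c-strict ← some-strict not-tight
    with d , c≢d , d-strict ← another-strict c c-strict
    -- The weights are the indicators of the two deficient classes, of total 2.
    = subst (λ x → suc k * r + x ≤ k * n)
        (trans (∑-distrib-+ (λ e → ⟦ does (c ≟ e) ⟧) (λ e → ⟦ does (d ≟ e) ⟧)) (cong₂ _+_ (#-singleton c) (#-singleton d)))
        (weighted-bound (λ e → ⟦ does (c ≟ e) ⟧ + ⟦ does (d ≟ e) ⟧) bound)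
    where
    bound : ∀ e → r + size e + (⟦ does (c ≟ e) ⟧ + ⟦ does (d ≟ e) ⟧) ≤ n
    bound e with c ≟ e | d ≟ e
    ... | yes refl | yes refl = contradiction refl c≢d
    ... | yes refl | no _     = subst (_≤ n) (ℕ.+-comm 1 _) c-strict
    ... | no _     | yes refl = subst (_≤ n) (ℕ.+-comm 1 _) d-strict
    ... | no _     | no _     = subst (_≤ n) (sym (ℕ.+-identityʳ _)) (class≤ e)

-- Layered graphs.

-- One full copy of M on p + e vertices together with s partial copies on the
-- first p vertices; vertices of distinct copies are adjacent according to N.
module Layering {p e} (M N : Graph (p + e)) where
  private
    module M = Graph M
    module N = Graph N

  module _ (s : ℕ) where

    adjacent : Fin (suc s) × Fin (p + e) → Fin (suc s) × Fin (p + e) → Bool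
    adjacent (i , x) (j , y) = if does (i ≟ j) then M.adj x y else N.adj x y

    adjacent-sym : ∀ u v → adjacent u v ≡ adjacent v u
    adjacent-sym (i , x) (j , y)
      rewrite does-⇔ (mk⇔ sym sym) (i ≟ j) (j ≟ i) | M.adj-sym x y | N.adj-sym x y = refl

    adjacent-irrefl : ∀ v → adjacent v v ≡ false
    adjacent-irrefl (i , x) rewrite dec-true (i ≟ i) refl = M.no-loop x

    -- Pairs `(suc i , x)` with `x` among the last `e` vertices are never reached; this makes those
    -- copies partial.
    place : Fin (p + e + s * p) → Fin (suc s) × Fin (p + e)
    place v = [ zero ,_ , map suc (_↑ˡ e) ∘ remQuot p ]′ (splitAt (p + e) v)

    place-↑ˡ : ∀ x → place (x ↑ˡ (s * p)) ≡ (zero , x)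
    place-↑ˡ x rewrite splitAt-↑ˡ (p + e) x (s * p) = refl

    place-↑ʳ : ∀ i y → place ((p + e) ↑ʳ combine i y) ≡ (suc i , y ↑ˡ e)
    place-↑ʳ i y rewrite splitAt-↑ʳ (p + e) (s * p) (combine i y) =
      cong (map suc (_↑ˡ e)) (remQuot-combine i y)

    graph : Graph (p + e + s * p)
    graph = record
      { adj     = λ u v → adjacent (place u) (place v)
      ; adj-sym = λ u v → adjacent-sym (place u) (place v)
      ; no-loop = adjacent-irrefl ∘ place
      }

    #-place : ∀ f → # (f ∘ place) ≡ # (λ x → f (zero , x)) + ∑[ i < s ] # (λ y → f (suc i , y ↑ˡ e))
    #-place f = trans (∑-+ (p + e) (⟦_⟧ ∘ f ∘ place)) (cong₂ _+_
      (sum-cong-≗ λ x → cong (⟦_⟧ ∘ f) (place-↑ˡ x))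
      (trans (∑-* s (λ v → ⟦ f (place ((p + e) ↑ʳ v)) ⟧))
        (sum-cong-≗ λ i → sum-cong-≗ λ y → cong (⟦_⟧ ∘ f) (place-↑ʳ i y))))

    -- A vertex of a partial copy has # (N.adj x) neighbours in the full copy
    -- and # (M.adj x) restricted to p in its own copy, which together must make up a + b.
    graph-regular : ∀ {a b} → (∀ x → # (M.adj x) ≡ a) → (∀ x → # (λ y → N.adj x (y ↑ˡ e)) ≡ b) →
                    (∀ x → # (N.adj (x ↑ˡ e)) + # (λ y → M.adj (x ↑ˡ e) (y ↑ˡ e)) ≡ a + b) →
                    IsRegular graph (a + s * b)
    graph-regular {a} {b} full partial balanced v =
      trans (degree≡# graph v) (trans (#-place (adjacent (place v))) (count v))
      where
      Goal : Fin (suc s) × Fin (p + e) → Set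
      Goal u = # (λ x → adjacent u (zero , x)) + ∑[ i < s ] # (λ y → adjacent u (suc i , y ↑ˡ e)) ≡ a + s * b

      count-zero : ∀ x → Goal (zero , x)
      count-zero x = cong₂ _+_ (full x) (trans (sum-cong-≗ {s} λ _ → partial x) (∑-const s b))

      count-suc : ∀ i x → Goal (suc i , x ↑ˡ e)
      -- The own copy contributes `m` in place of `b`. Adding `b` to both sides avoids the count s -
      -- 1 of the other partial copies.
      count-suc i x = ℕ.+-cancelʳ-≡ b _ _ (begin
        # (N.adj x′) + ∑[ j < s ] # (λ y → adjacent (suc i , x′) (suc j , y ↑ˡ e)) + b
          ≡⟨ cong (λ z → # (N.adj x′) + z + b) (sum-cong-≗ own) ⟩
        # (N.adj x′) + ∑[ j < s ] (if does (i ≟ j) then m else b) + b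
          ≡⟨ ℕ.+-assoc (# (N.adj x′)) _ b ⟩
        # (N.adj x′) + (∑[ j < s ] (if does (i ≟ j) then m else b) + b)
          ≡⟨ cong (# (N.adj x′) +_) (∑-if i m b) ⟩
        # (N.adj x′) + (m + s * b)
          ≡⟨ ℕ.+-assoc (# (N.adj x′)) m _ ⟨
        # (N.adj x′) + m + s * b
          ≡⟨ cong (_+ s * b) (balanced x) ⟩
        a + b + s * b
          ≡⟨ identity a b (s * b) ⟩
        a + s * b + b ∎)
        where
        open ≡-Reasoning
        x′ = x ↑ˡ e
        m = # (λ y → M.adj x′ (y ↑ˡ e))
        identity : ∀ a b c → a + b + c ≡ a + c + b
        identity = solve-∀
        own : ∀ j → # (λ y → adjacent (suc i , x′) (suc j , y ↑ˡ e)) ≡ (if does (i ≟ j) then m else b)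
        own j with does (i ≟ j)
        ... | true  = refl
        ... | false = partial x′

      count : ∀ v → Goal (place v)
      count v with splitAt (p + e) v
      ... | inj₁ x = count-zero x
      ... | inj₂ w = count-suc (proj₁ (remQuot {s} p w)) (proj₂ (remQuot {s} p w))

    -- All copies are coloured alike: an edge inside a copy comes from `M`, an edge between copies
    -- from `N`.
    graph-colouring : ∀ {k} (f : Fin (p + e) → Fin k) →
                      (∀ x y → x M.~ y → f x ≢ f y) → (∀ x y → x N.~ y → f x ≢ f y) → Colourable graph k
    graph-colouring f M-proper N-proper = f ∘ proj₂ ∘ place , λ u v → proper (place u) (place v)
      where
      proper : ∀ u v → adjacent u v ≡ true → f (proj₂ u) ≢ f (proj₂ v)
      proper (i , x) (j , y) with does (i ≟ j)
      ... | true  = M-proper x y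
      ... | false = N-proper x y

    graph-clique : ∀ {k} {c : Fin k → Fin (p + e)} → Clique M c → Clique graph (λ i → c i ↑ˡ (s * p))
    graph-clique {c = c} c-clique i j i≢j rewrite place-↑ˡ (c i) | place-↑ˡ (c j) = c-clique i j i≢j

-- Multipartite building blocks.

-- Vertices at distance d in the enumeration are not joined.  With d = 0 this
-- removes nothing; with d = 1 it removes the paths formed by maximal runs of
-- consecutive vertices of distinct colours.
multipartite : ∀ {n k} → Vec (Fin k) n → ℕ → Graph n
multipartite κ d = record
  { adj     = λ x y → not (does (lookup κ x ≟ lookup κ y)) ∧ not (does (∣ toℕ x - toℕ y ∣ ℕ.≟ d))
  ; adj-sym = λ x y → cong₂ (λ a b → not a ∧ not b)
      (does-⇔ (mk⇔ sym sym) (lookup κ x ≟ lookup κ y) (lookup κ y ≟ lookup κ x))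
      (cong (λ m → does (m ℕ.≟ d)) (ℕ.∣-∣-comm (toℕ x) (toℕ y)))
  ; no-loop = λ x → cong (λ b → not b ∧ not (does (∣ toℕ x - toℕ x ∣ ℕ.≟ d)))
      (dec-true (lookup κ x ≟ lookup κ x) refl)
  }

multipartite-proper : ∀ {n k} (κ : Vec (Fin k) n) d x y →
  Graph.adj (multipartite κ d) x y ≡ true → lookup κ x ≢ lookup κ y
multipartite-proper κ d x y x~y with lookup κ x ≟ lookup κ y
... | no ≢ = ≢

module Construction {p e} (κ : Vec (Fin 3) (p + e)) (d a b : ℕ) (t : Vec (Fin (p + e)) 3) where
  M N : Graph (p + e)
  M = multipartite κ d
  N = multipartite κ 0

  open Graph M using () renaming (adj to adjᴹ)
  open Graph N using () renaming (adj to adjᴺ)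

  -- No condition mentions s, so one evaluation on p + e vertices settles a whole infinite family.
  Valid : Set
  Valid = (∀ x → # (adjᴹ x) ≡ a)
        × (∀ x → # (λ y → adjᴺ x (y ↑ˡ e)) ≡ b)
        × (∀ x → # (adjᴺ (x ↑ˡ e)) + # (λ y → adjᴹ (x ↑ˡ e) (y ↑ˡ e)) ≡ a + b)
        × Clique M (lookup t)

  valid? : Dec Valid
  valid? = all? (λ x → # (adjᴹ x) ℕ.≟ a)
    ×-dec all? (λ x → # (λ y → adjᴺ x (y ↑ˡ e)) ℕ.≟ b)
    ×-dec all? (λ x → # (adjᴺ (x ↑ˡ e)) + # (λ y → adjᴹ (x ↑ˡ e) (y ↑ˡ e)) ℕ.≟ a + b)
    ×-dec all? (λ i → all? λ j → ¬? (i ≟ j) →-dec (adjᴹ (lookup t i) (lookup t j) Bool.≟ true))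

  open Layering {p} {e} M N

  isRGχGraph : Valid → ∀ s → IsRGχGraph (a + s * b) 3 3 (graph s)
  isRGχGraph (full , partial , balanced , clique) s = record
    { regular   = graph-regular s full partial balanced
    ; girth     = triangle⇒girth3 (graph s) (graph-clique s clique)
    ; chromatic = graph-colouring s (lookup κ) (multipartite-proper κ d) (multipartite-proper κ 0)
                , λ k → clique-order (graph s) (graph-clique s clique)
    }

-- The three families of cages.

cage-2+2s : ∀ s → n⟨ 2 + s * 2 , 3 , 3 ⟩≡ 3 + s * 3
cage-2+2s s = _ , record
  { isRGχGraph = C.isRGχGraph (from-yes C.valid?) s
  ; minimum    = λ {n} H H-is → let open IsRGχGraph H-is in
      ℕ.*-cancelˡ-≤ 2 (subst (_≤ 2 * n) (double s) (ColourClasses.order-bound H regular chromatic))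
  }
  where
  -- `M` and `N` are both triangles, so the layers form K_{k,k,k} with k = s + 1.
  module C = Construction {3} {0} (0F ∷ 1F ∷ 2F ∷ []) 0 2 2 (0F ∷ 1F ∷ 2F ∷ [])
  double : ∀ s → 3 * (2 + s * 2) ≡ 2 * (3 + s * 3)
  double = solve-∀

cage-3+4s : ∀ s → n⟨ 3 + s * 4 , 3 , 3 ⟩≡ 6 + s * 6
cage-3+4s s = _ , record
  { isRGχGraph = C.isRGχGraph (from-yes C.valid?) s
  ; minimum    = λ {n} H H-is → let open IsRGχGraph H-is in
      -- Since 3r is odd it differs from 2n, and the gap gives 11 + 12s ≤ 2n, hence 5 + 6s < n.
      ℕ.*-cancelˡ-< 2 (5 + s * 6) n (subst (_≤ 2 * n) (gap s)
        (ColourClasses.order-gap H regular chromatic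
          (λ tight → ℕ.even≢odd n (4 + s * 6) (trans (sym tight) (odd s)))))
  }
  where
  -- The consecutive positions of distinct colours are 01, 23 and 45, a perfect matching of
  -- K_{2,2,2}.
  module C = Construction {6} {0} (0F ∷ 1F ∷ 1F ∷ 2F ∷ 2F ∷ 0F ∷ []) 1 3 4 (0F ∷ 2F ∷ 4F ∷ [])
  odd : ∀ s → 3 * (3 + s * 4) ≡ suc (2 * (4 + s * 6))
  odd = solve-∀
  gap : ∀ s → 3 * (3 + s * 4) + 2 ≡ suc (2 * (5 + s * 6))
  gap = solve-∀

-- The six core vertices are a removed P₆, the four extra ones the removed P₄.
cage-5+4s : ∀ s → n⟨ 5 + s * 4 , 3 , 3 ⟩≡ 10 + s * 6
cage-5+4s s = _ , record
  { isRGχGraph = C.isRGχGraph (from-yes C.valid?) s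
  ; minimum    = λ {n} H H-is → let open IsRGχGraph H-is in
      -- The gap gives only 9 + 6s ≤ n; equality would make n * r odd, against the handshake lemma.
      ℕ.≤∧≢⇒<
        (ℕ.*-cancelˡ-< 2 (8 + s * 6) n (subst (_≤ 2 * n) (gap s)
          (ColourClasses.order-gap H regular chromatic
            (λ tight → ℕ.even≢odd n (7 + s * 6) (trans (sym tight) (odd s))))))
        (λ { refl → case handshake H regular of λ { (divides q eq) →
          ℕ.even≢odd q (22 + s * 33 + s * s * 12) (trans (ℕ.*-comm 2 q) (trans (sym eq) (odd-product s))) } })
  }
  where
  -- The path ends are the vertices of colour 0, the larger class. They lose one edge and all others
  -- two, which evens out the degrees.
  module C = Construction {6} {4} (0F ∷ 1F ∷ 2F ∷ 1F ∷ 2F ∷ 0F ∷ 0F ∷ 1F ∷ 2F ∷ 0F ∷ []) 1 5 4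
                          (0F ∷ 3F ∷ 8F ∷ [])
  odd : ∀ s → 3 * (5 + s * 4) ≡ suc (2 * (7 + s * 6))
  odd = solve-∀
  gap : ∀ s → 3 * (5 + s * 4) + 2 ≡ suc (2 * (8 + s * 6))
  gap = solve-∀
  odd-product : ∀ s → (9 + s * 6) * (5 + s * 4) ≡ suc (2 * (22 + s * 33 + s * s * 12))
  odd-product = solve-∀

-- Case distinction on r modulo 4.

2∤⇒odd : ∀ n → 2 ∤ n → ∃ λ k → n ≡ suc (k * 2)
2∤⇒odd zero          2∤n = contradiction (2 ∣0) 2∤n
2∤⇒odd (suc zero)    2∤n = 0 , refl
2∤⇒odd (suc (suc n)) 2∤n = case 2∤⇒odd n (2∤n ∘ ∣m∣n⇒∣m+n ∣-refl) of λ { (k , refl) → suc k , refl }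

⌈1+k*2/2⌉ : ∀ k → ⌈ suc (k * 2) /2⌉ ≡ suc k
⌈1+k*2/2⌉ zero    = refl
⌈1+k*2/2⌉ (suc k) = cong suc (⌈1+k*2/2⌉ k)

theorem3p2 : ∀ (r : ℕ) → 2 ≤ r →
    (2 ∣ r → n⟨ r , 3 , 3 ⟩≡ r + r / 2) ×
    (2 ∤ r → 2 ∣ ⌈ r /2⌉ → n⟨ r , 3 , 3 ⟩≡ r + ⌈ r /2⌉ + 1) ×
    (2 ∤ r → 2 ∤ ⌈ r /2⌉ → n⟨ r , 3 , 3 ⟩≡ r + ⌈ r /2⌉ + 2)
theorem3p2 r 2≤r = even , odd-even , odd-odd
  where
  even : 2 ∣ r → n⟨ r , 3 , 3 ⟩≡ r + r / 2
  even (divides-refl zero)    = case 2≤r of λ ()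
  even (divides-refl (suc s)) =
    subst (n⟨ 2 + s * 2 , 3 , 3 ⟩≡_)
      (trans (identity s) (cong (2 + s * 2 +_) (sym (m*n/n≡m (suc s) 2)))) (cage-2+2s s)
    where
    identity : ∀ s → 3 + s * 3 ≡ 2 + s * 2 + suc s
    identity = solve-∀

  odd-even : 2 ∤ r → 2 ∣ ⌈ r /2⌉ → n⟨ r , 3 , 3 ⟩≡ r + ⌈ r /2⌉ + 1
  odd-even 2∤r 2∣⌈r/2⌉ with k , refl ← 2∤⇒odd r 2∤r rewrite ⌈1+k*2/2⌉ k with 2∣⌈r/2⌉
  -- Here k + 1 = 2(s + 1), so r = 2k + 1 = 3 + 4s.
  ... | divides (suc s) refl = subst₂ n⟨_, 3 , 3 ⟩≡_ (degree s) (order s) (cage-3+4s s)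
    where
    degree : ∀ s → 3 + s * 4 ≡ suc (suc (s * 2) * 2)
    degree = solve-∀
    order : ∀ s → 6 + s * 6 ≡ suc (suc (s * 2) * 2) + suc (suc (s * 2)) + 1
    order = solve-∀

  odd-odd : 2 ∤ r → 2 ∤ ⌈ r /2⌉ → n⟨ r , 3 , 3 ⟩≡ r + ⌈ r /2⌉ + 2
  odd-odd 2∤r 2∤⌈r/2⌉ with k , refl ← 2∤⇒odd r 2∤r rewrite ⌈1+k*2/2⌉ k with 2∤⇒odd (suc k) 2∤⌈r/2⌉
  -- This case is r = 1, excluded by `2≤r`; the next one is r = 5 + 4s.
  ... | zero  , refl = case 2≤r of λ { (s≤s ()) }
  ... | suc s , refl = subst₂ n⟨_, 3 , 3 ⟩≡_ (degree s) (order s) (cage-5+4s s)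
    where
    degree : ∀ s → 5 + s * 4 ≡ suc (suc (suc (s * 2)) * 2)
    degree = solve-∀
    order : ∀ s → 10 + s * 6 ≡ suc (suc (suc (s * 2)) * 2) + suc (suc (suc (s * 2))) + 2
    order = solve-∀
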